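{- Let $q\equiv 1\pmod 6$ be a prime power, let $\rho$ be a primitive element of $\mathbb F_q$, and let $\pi : (\mathbb Z_2^2)^* \to \mathbb Z_3$ be a bijection. Suppose $c = c^3_q(1,2)$ is odd and $l = (c+1)/2$. Then $\operatorname{Cay}(G_{l,2,q},S(\pi))$ is edge-regular with parameters $(4lq,\ 4l-2+q,\ 4l-2)$ and has a regular clique of order $4l$.
   Context: For an additive group $A$, $A^*=A\setminus\{0\}$. $G_{l,2,q}=\mathbb Z_l\oplus\mathbb Z_2^2\oplus\mathbb F_q$. $S_0=\{(g,0): g\in(\mathbb Z_l\oplus\mathbb Z_2^2)^*\}$; for $z\in(\mathbb Z_2^2)^*$, $S_{z,\pi}=\{(0,z,\rho^j): j\in\mathbb Z,\ j\equiv\pi(z)\pmod 3\}$; $S(\pi)=S_0\cup\bigcup_z S_{z,\pi}$; $\operatorname{Cay}(G_{l,2,q},S(\pi))$ has vertex set $G_{l,2,q}$ with $x\sim y$ iff $y-x\in S(\pi)$. Write $q=6r+1$; $C^3_q(i)=\{\rho^{3j+i}:0\le j\le 2r-1\}$ for $i\in\mathbb Z_3$, $c^3_q(a,b)=|(C^3_q(a)+1)\cap C^3_q(b)|$. A graph is edge-regular with parameters $(N,k,\lambda)$ if it is non-empty, has $N$ vertices, is $k$-regular, and every two adjacent vertices have exactly $\lambda$ common neighbours. A clique $\mathcal C$ is regular if every vertex outside $\mathcal C$ is adjacent to the same number $e>0$ of vertices of $\mathcal C$. -}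

module Defs where

open import Level using (Level; _⊔_; suc; 0ℓ)
open import Algebra.Bundles using (AbelianGroup; CommutativeRing)
open import Algebra.Construct.DirectProduct using () renaming (abelianGroup to _⊕_)
import Algebra.Properties.Semiring.Exp as SemiringExp
open import Data.Fin.Base using (Fin)
open import Data.Integer.Base as ℤ using (ℤ; +_; -[1+_]; 0ℤ)
import Data.Integer.Properties as ℤ
open import Data.Integer.Divisibility.Signed using (_∣_; divides; ∣m∣n⇒∣m+n; ∣m⇒∣-m)
open import Data.Integer.Tactic.RingSolver using (solve-∀)
open import Data.Nat.Base as ℕ using (ℕ)
open import Data.Nat.Primality using (Prime)
open import Data.Product.Base using (Σ; ∃; ∃-syntax; _×_; _,_; proj₁)
open import Function.Bundles using (Bijection)
open import Relation.Binary.Bundles using (Setoid)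
open import Relation.Binary.Core using (Rel)
open import Relation.Binary.Definitions using (Symmetric; _Respects_; _Respects₂_)
import Relation.Binary.Construct.On as On
open import Relation.Binary.PropositionalEquality as ≡ using (_≡_; subst)
open import Relation.Nullary.Negation.Core using (¬_)
open import Relation.Unary using (Pred; _∈_; _∉_; _∩_; _∪_; ⋃)

private
  variable
    a c ℓ p : Level

infix 5 _↾_
_↾_ : (A : Setoid a ℓ) → Pred (Setoid.Carrier A) p → Setoid (a ⊔ p) ℓ
A ↾ P = On.setoid {B = ∃ P} A proj₁

infix 4 ∣_∣≡_
∣_∣≡_ : Setoid a ℓ → ℕ → Set (a ⊔ ℓ)
∣ A ∣≡ n = Bijection (≡.setoid (Fin n)) A

infix 4 _≡_[mod_]
record _≡_[mod_] (x y : ℤ) (n : ℕ) : Set where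
  constructor mod
  field
    n∣x-y : + n ∣ x ℤ.- y

module _ (n : ℕ) where

  private
    by : ∀ {x y z} → z ≡ x ℤ.- y → + n ∣ z → x ≡ y [mod n ]
    by eq d = mod (subst (+ n ∣_) eq d)

  -- ℤ/nℤ, carried by ℤ itself with congruence modulo n as its equality
  ℤ/ : AbelianGroup 0ℓ 0ℓ
  ℤ/ = record
    { Carrier = ℤ
    ; _≈_     = λ x y → x ≡ y [mod n ]
    ; _∙_     = ℤ._+_
    ; ε       = 0ℤ
    ; _⁻¹     = ℤ.-_
    ; isAbelianGroup = record
      { isGroup = record
        { isMonoid = record
          { isSemigroup = record
            { isMagma = record
              { isEquivalence = record
                { refl  = reflexive ≡.refl
                ; sym   = λ {x} {y} → λ where
                    (mod d) → by (negSub x y) (∣m⇒∣-m d)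
                ; trans = λ {x} {y} {z} → λ where
                    (mod d) (mod e) → by (telescope x y z) (∣m∣n⇒∣m+n d e)
                }
              ; ∙-cong = λ {x} {y} {u} {v} → λ where
                  (mod d) (mod e) → by (addSub x y u v) (∣m∣n⇒∣m+n d e)
              }
            ; assoc = λ x y z → reflexive (ℤ.+-assoc x y z)
            }
          ; identity = (λ x → reflexive (ℤ.+-identityˡ x))
                     , (λ x → reflexive (ℤ.+-identityʳ x))
          }
        ; inverse = (λ x → reflexive (ℤ.+-inverseˡ x))
                  , (λ x → reflexive (ℤ.+-inverseʳ x))
        ; ⁻¹-cong = λ {x} {y} → λ where
            (mod d) → by (negCong x y) (∣m⇒∣-m d)
        }
      ; comm = λ x y → reflexive (ℤ.+-comm x y)
      }
    }
    where
    reflexive : ∀ {x y} → x ≡ y → x ≡ y [mod n ]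
    reflexive {x} ≡.refl = by (≡.sym (ℤ.+-inverseʳ x)) (divides 0ℤ ≡.refl)

    negSub : ∀ x y → ℤ.- (x ℤ.- y) ≡ y ℤ.- x
    negSub = solve-∀

    telescope : ∀ x y z → (x ℤ.- y) ℤ.+ (y ℤ.- z) ≡ x ℤ.- z
    telescope = solve-∀

    addSub : ∀ x y u v → (x ℤ.- y) ℤ.+ (u ℤ.- v) ≡ (x ℤ.+ u) ℤ.- (y ℤ.+ v)
    addSub = solve-∀

    negCong : ∀ x y → ℤ.- (x ℤ.- y) ≡ (ℤ.- x) ℤ.- (ℤ.- y)
    negCong = solve-∀

ℤ₂² : AbelianGroup 0ℓ 0ℓ
ℤ₂² = ℤ/ 2 ⊕ ℤ/ 2

infix 10 _*
_* : AbelianGroup a ℓ → Setoid (a ⊔ ℓ) ℓ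
A * = setoid ↾ λ x → ¬ (x ≈ ε)
  where open AbelianGroup A using (setoid; _≈_; ε)

IsPrimePower : ℕ → Set
IsPrimePower q = ∃[ p ] ∃[ e ] Prime p × 1 ℕ.≤ e × q ≡ p ℕ.^ e

record Field c ℓ : Set (suc (c ⊔ ℓ)) where
  field
    commutativeRing : CommutativeRing c ℓ
  open CommutativeRing commutativeRing public
  infix 8 _⁻¹
  field
    -- total for convenience; the value at 0# is unconstrained
    _⁻¹        : Carrier → Carrier
    *-inverseʳ : ∀ x → ¬ (x ≈ 0#) → x * x ⁻¹ ≈ 1#
    1≉0        : ¬ (1# ≈ 0#)

module Cyclotomy (F : Field c ℓ) where
  open Field F using (Carrier; _≈_; 0#; 1#; _+_; _⁻¹; semiring)
  open SemiringExp semiring using (_^_)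

  -- meaningful only for nonzero x
  infixr 8 _^ᶻ_
  _^ᶻ_ : Carrier → ℤ → Carrier
  x ^ᶻ (+ n)    = x ^ n
  x ^ᶻ -[1+ n ] = (x ⁻¹) ^ ℕ.suc n

  IsPrimitive : Carrier → Set (c ⊔ ℓ)
  IsPrimitive ρ = ¬ (ρ ≈ 0#) × (∀ x → ¬ (x ≈ 0#) → ∃[ j ] x ≈ ρ ^ᶻ j)

  -- The class i ∈ ℤ/3 is given by any integer representative.  When ρ is
  -- primitive in a field of order 6r + 1, ρ has order 6r, so the set does not
  -- depend on the representative.
  C³ : (ρ : Carrier) (r : ℕ) (i : AbelianGroup.Carrier (ℤ/ 3)) → Pred Carrier ℓ
  C³ ρ r i x = Σ ℕ λ j → j ℕ.< 2 ℕ.* r × x ≈ ρ ^ᶻ (+ 3 ℤ.* + j ℤ.+ i)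

  _+1 : Pred Carrier ℓ → Pred Carrier (c ⊔ ℓ)
  (P +1) x = ∃[ y ] y ∈ P × x ≈ y + 1#

  c³-set : (ρ : Carrier) (r : ℕ) (a b : AbelianGroup.Carrier (ℤ/ 3)) → Setoid (c ⊔ ℓ) ℓ
  c³-set ρ r a b = Field.setoid F ↾ (C³ ρ r a +1) ∩ C³ ρ r b

record Graph v ℓ e : Set (suc (v ⊔ ℓ ⊔ e)) where
  field
    vertices : Setoid v ℓ
  open Setoid vertices public renaming (Carrier to V)
  infix 4 _~_
  field
    _~_ : Rel V e

module _ {v ℓ e} (Γ : Graph v ℓ e) where
  open Graph Γ

  record IsSimple : Set (v ⊔ ℓ ⊔ e) where
    field
      ~-resp-≈ : _~_ Respects₂ _≈_
      ~-sym    : Symmetric _~_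
      loopless : ∀ {x} → ¬ (x ~ x)

  -- Graph imposes no conditions on _~_, so being a simple graph is part of
  -- edge-regularity; `nonEmpty` is the usual sense of having an edge.
  record IsEdgeRegular (N k λ′ : ℕ) : Set (v ⊔ ℓ ⊔ e) where
    field
      isSimple         : IsSimple
      nonEmpty         : ∃[ x ] ∃[ y ] x ~ y
      order            : ∣ vertices ∣≡ N
      regular          : ∀ x → ∣ vertices ↾ (x ~_) ∣≡ k
      commonNeighbours : ∀ x y → x ~ y → ∣ vertices ↾ (x ~_) ∩ (y ~_) ∣≡ λ′

  record IsClique (𝒞 : Pred V p) : Set (v ⊔ ℓ ⊔ e ⊔ p) where
    field
      resp-≈   : 𝒞 Respects _≈_
      adjacent : ∀ {x y} → x ∈ 𝒞 → y ∈ 𝒞 → ¬ (x ≈ y) → x ~ y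

  record IsRegularClique (𝒞 : Pred V p) : Set (v ⊔ ℓ ⊔ e ⊔ p) where
    field
      isClique : IsClique 𝒞
      nexus    : ℕ
      nexus>0  : 0 ℕ.< nexus
      regular  : ∀ x → x ∉ 𝒞 → ∣ vertices ↾ (x ~_) ∩ 𝒞 ∣≡ nexus

  HasRegularCliqueOfOrder : ℕ → Set (v ⊔ suc ℓ ⊔ e)
  HasRegularCliqueOfOrder m =
    Σ (Pred V ℓ) λ 𝒞 → IsRegularClique 𝒞 × (∣ vertices ↾ 𝒞 ∣≡ m)

Cay : (G : AbelianGroup a ℓ) → Pred (AbelianGroup.Carrier G) p → Graph a ℓ p
Cay G S = record
  { vertices = setoid
  ; _~_      = λ x y → y ∙ x ⁻¹ ∈ S
  }
  where open AbelianGroup G using (setoid; _∙_; _⁻¹)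

module Construction (l : ℕ) (F : Field c ℓ) (ρ : Field.Carrier F)
                    (π : Bijection (ℤ₂² *) (AbelianGroup.setoid (ℤ/ 3))) where
  open Field F using (0#; +-abelianGroup)
  open Cyclotomy F using (_^ᶻ_)
  open Bijection π using (to)

  -- elements are written ((g , z) , x)
  G : AbelianGroup c ℓ
  G = (ℤ/ l ⊕ ℤ₂²) ⊕ +-abelianGroup

  open AbelianGroup G using (Carrier; _≈_)

  S₀ : Pred Carrier ℓ
  S₀ s = Σ (Setoid.Carrier ((ℤ/ l ⊕ ℤ₂²) *)) λ (g , _) → s ≈ (g , 0#)

  S[_] : Setoid.Carrier (ℤ₂² *) → Pred Carrier ℓ
  S[ z ] s = ∃[ j ] j ≡ to z [mod 3 ] × s ≈ ((0ℤ , proj₁ z) , ρ ^ᶻ j)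

  S : Pred Carrier ℓ
  S = S₀ ∪ ⋃ (Setoid.Carrier (ℤ₂² *)) S[_]

{-# OPTIONS --safe #-}
-- S consists of the nonzero elements of A = ℤ/l ⊕ ℤ₂² together with one element (0 , z , x) for each
-- x ≢ 0, where z is determined by the cubic class of x.  By translation, the common neighbours of the
-- ends of an edge with difference s correspond to the t with t ∈ S and t - s ∈ S.  For s = (g , 0) these
-- are the elements of A ∖ {0 , g}.  For s = (0 , z , x) with x of class k they are the (0 , z′ , y) with
-- z′ and z′ - z the other two nonzero elements of ℤ₂², so that y and y - x have classes k+1 and k+2 in
-- one of the two orders; each order contributes c solutions y, and 2 c = 4 l - 2.  In the clique A ⊕ 0
-- the only neighbour of (a , x) is a plus the label z of - x.
module Submission where

open import Defs
open import Level using (Level; 0ℓ)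
open import Algebra.Bundles using (AbelianGroup)
open import Algebra.Construct.DirectProduct using () renaming (abelianGroup to _⊕_)
import Algebra.Properties.AbelianGroup as AbelianGroupProperties
import Algebra.Properties.Ring as RingProperties
open import Data.Fin.Base as Fin using (Fin; toℕ; fromℕ<; punchIn; punchOut)
import Data.Fin.Properties as Fin
open import Data.Integer.Base as ℤ using (ℤ; +_; -[1+_]; 0ℤ; -1ℤ; 1ℤ)
import Data.Integer.Properties as ℤ
open import Data.Integer.DivMod using (_%ℕ_; _/ℕ_; a≡a%ℕn+[a/ℕn]*n; n%ℕd<d)
open import Data.Integer.Divisibility.Signed as ℤ using (_∣_; divides; ∣⇒∣ᵤ; ∣ᵤ⇒∣)
open import Data.Integer.Tactic.RingSolver using (solve-∀)
open import Data.Nat.Base as ℕ using (ℕ; zero; suc; _∸_; _≤_; _<_)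
import Data.Nat.Properties as ℕ
import Data.Nat.Divisibility as ℕ
open import Data.Nat.DivMod as ℕ using (_/_; _%_)
import Data.Nat.Tactic.RingSolver as ℕSolver
open import Data.Product.Base using (Σ-syntax; ∃-syntax; _×_; _,_; proj₁; proj₂)
open import Data.Product.Function.NonDependent.Setoid using (_×-inverse_)
open import Data.Product.Relation.Binary.Pointwise.NonDependent as × using (_×ₛ_)
open import Data.Sum.Base as Sum using (_⊎_; inj₁; inj₂; [_,_]′)
open import Data.Sum.Function.Setoid using (_⊎-inverse_)
open import Data.Sum.Relation.Binary.Pointwise as ⊎ using (_⊎ₛ_; inj₁; inj₂)
open import Function.Base using (_∘_; id)
open import Function.Bundles using (Bijection; Inverse)
import Function.Construct.Composition as Composition
import Function.Construct.Identity as Identity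
import Function.Construct.Symmetry as Symmetry
open import Function.Properties.Bijection using (Bijection⇒Inverse)
open import Function.Properties.Inverse using (Inverse⇒Bijection)
open import Relation.Binary.Bundles using (Setoid)
open import Relation.Binary.Definitions using (_Respects_)
open import Relation.Binary.PropositionalEquality as ≡ using (_≡_; _≢_)
open import Relation.Nullary.Negation.Core using (¬_; contradiction)
open import Relation.Unary using (Pred; _∈_; _∪_; _⊆_; _≐_)

private
  variable
    a b ℓ ℓ₁ ℓ₂ p s t : Level
    X : Setoid a ℓ₁
    Y : Setoid b ℓ₂
    m n : ℕ

-- Counting in setoids

module _ (X : Setoid a ℓ₁) (Y : Setoid b ℓ₂) where
  private
    module X = Setoid X
    module Y = Setoid Y

  -- The `inverse` field of `Inverse` speaks of all pairs of equal elements. Once both maps are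
  -- congruences, pointwise round trips suffice.
  mkInverse : (to : X.Carrier → Y.Carrier) (from : Y.Carrier → X.Carrier) →
              (∀ {x y} → x X.≈ y → to x Y.≈ to y) →
              (∀ {x y} → x Y.≈ y → from x X.≈ from y) →
              (∀ y → to (from y) Y.≈ y) → (∀ x → from (to x) X.≈ x) → Inverse X Y
  mkInverse to from to-cong from-cong to∘from from∘to = record
    { to = to; from = from; to-cong = to-cong; from-cong = from-cong
    ; inverse = (λ {x} eq → Y.trans (to-cong eq) (to∘from x))
              , (λ {x} eq → X.trans (from-cong eq) (from∘to x))
    }

∣∣-resp-≡ : m ≡ n → ∣ X ∣≡ m → ∣ X ∣≡ n
∣∣-resp-≡ ≡.refl = id

∣∣-resp-↔ : Inverse X Y → ∣ X ∣≡ n → ∣ Y ∣≡ n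
∣∣-resp-↔ X↔Y ∣X∣ = Composition.bijection ∣X∣ (Inverse⇒Bijection X↔Y)

-- Equality in `X ↾ P` ignores the membership proof, so the laws of `X↔Y` carry over as they stand.
↾-↔ : {P : Pred (Setoid.Carrier X) p} {Q : Pred (Setoid.Carrier Y) s} (X↔Y : Inverse X Y) →
      (∀ {x} → P x → Q (Inverse.to X↔Y x)) → (∀ {y} → Q y → P (Inverse.from X↔Y y)) →
      Inverse (X ↾ P) (Y ↾ Q)
↾-↔ X↔Y P⇒Q Q⇒P = record
  { to = λ (x , px) → to x , P⇒Q px; from = λ (y , qy) → from y , Q⇒P qy
  ; to-cong = to-cong; from-cong = from-cong
  ; inverse = inverseˡ , inverseʳ
  }
  where open Inverse X↔Y

↾-≐ : {P : Pred (Setoid.Carrier X) p} {Q : Pred (Setoid.Carrier X) s} →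
      P ≐ Q → ∣ X ↾ P ∣≡ n → ∣ X ↾ Q ∣≡ n
↾-≐ {X = X} (P⊆Q , Q⊆P) = ∣∣-resp-↔ (↾-↔ (Identity.inverse X) P⊆Q Q⊆P)

∣×∣ : ∣ X ∣≡ m → ∣ Y ∣≡ n → ∣ X ×ₛ Y ∣≡ m ℕ.* n
∣×∣ {m = m} {n = n} ∣X∣ ∣Y∣ = Inverse⇒Bijection
  (Composition.inverse (Fin.*↔× {m} {n})
  (Composition.inverse (Symmetry.inverse ×.Pointwise-≡↔≡)
  (Bijection⇒Inverse ∣X∣ ×-inverse Bijection⇒Inverse ∣Y∣)))

∣⊎∣ : ∣ X ∣≡ m → ∣ Y ∣≡ n → ∣ X ⊎ₛ Y ∣≡ m ℕ.+ n
∣⊎∣ {m = m} {n = n} ∣X∣ ∣Y∣ = Inverse⇒Bijection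
  (Composition.inverse (Fin.+↔⊎ {m} {n})
  (Composition.inverse (Symmetry.inverse (⊎.Pointwise-≡↔≡ _ _))
  (Bijection⇒Inverse ∣X∣ ⊎-inverse Bijection⇒Inverse ∣Y∣)))

module _ (X : Setoid a ℓ) {P : Pred (Setoid.Carrier X) p} {Q : Pred (Setoid.Carrier X) s} where
  open Setoid X

  -- Equality in the union does not see which side a membership proof takes. Disjointness excludes
  -- the mixed cases, and so makes the choice of side a congruence.
  ∣∪∣ : (∀ {x y} → P x → Q y → ¬ (x ≈ y)) →
        ∣ X ↾ P ∣≡ m → ∣ X ↾ Q ∣≡ n → ∣ X ↾ P ∪ Q ∣≡ m ℕ.+ n
  ∣∪∣ disjoint ∣P∣ ∣Q∣ = ∣∣-resp-↔ ⊎↔∪ (∣⊎∣ ∣P∣ ∣Q∣)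
    where
    from : Setoid.Carrier (X ↾ P ∪ Q) → Setoid.Carrier ((X ↾ P) ⊎ₛ (X ↾ Q))
    from (x , inj₁ px) = inj₁ (x , px)
    from (x , inj₂ qx) = inj₂ (x , qx)

    from-cong : ∀ x y → proj₁ x ≈ proj₁ y → Setoid._≈_ ((X ↾ P) ⊎ₛ (X ↾ Q)) (from x) (from y)
    from-cong (_ , inj₁ _)  (_ , inj₁ _)  eq = inj₁ eq
    from-cong (_ , inj₁ px) (_ , inj₂ qy) eq = contradiction eq (disjoint px qy)
    from-cong (_ , inj₂ qx) (_ , inj₁ py) eq = contradiction (sym eq) (disjoint py qx)
    from-cong (_ , inj₂ _)  (_ , inj₂ _)  eq = inj₂ eq

    ⊎↔∪ : Inverse ((X ↾ P) ⊎ₛ (X ↾ Q)) (X ↾ P ∪ Q)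
    ⊎↔∪ = mkInverse _ _
      [ (λ (x , px) → x , inj₁ px) , (λ (x , qx) → x , inj₂ qx) ]′ from
      (λ where (inj₁ eq) → eq
               (inj₂ eq) → eq)
      (λ {x} {y} → from-cong x y)
      (λ where (_ , inj₁ _) → refl
               (_ , inj₂ _) → refl)
      (λ where (inj₁ _) → inj₁ refl
               (inj₂ _) → inj₂ refl)

inhabited-∣∣≡0 : Setoid.Carrier X → ∣ X ∣≡ 0 → ∀ {w} {W : Set w} → W
inhabited-∣∣≡0 x ∣X∣ = contradiction (Inverse.from (Bijection⇒Inverse ∣X∣) x) λ ()

-- The index `i` of `x` is punched out of `Fin (suc n)`. Since `x` inhabits `X`, the truncated case
-- `n = 0` is vacuous.
∣≉∣ : (X : Setoid a ℓ) (x : Setoid.Carrier X) →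
      ∣ X ∣≡ n → ∣ X ↾ (λ y → ¬ (Setoid._≈_ X y x)) ∣≡ n ∸ 1
∣≉∣ {n = zero} X x ∣X∣ = inhabited-∣∣≡0 x ∣X∣
∣≉∣ {n = suc n} X x ∣X∣ = Inverse⇒Bijection (mkInverse _ _
  (λ k → to (punchIn i k) , λ eq → Fin.punchInᵢ≢i i k (≡.trans (≡.sym (strictlyInverseʳ _)) (from-cong eq)))
  (λ (y , y≉x) → punchOut (i≢from y≉x))
  (λ where ≡.refl → refl)
  (λ eq → Fin.punchOut-cong i (from-cong eq))
  (λ (y , y≉x) → trans (to-cong (Fin.punchIn-punchOut (i≢from y≉x))) (strictlyInverseˡ y))
  (λ k → ≡.trans (Fin.punchOut-cong i (strictlyInverseʳ _)) (Fin.punchOut-punchIn i)))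
  where
  open Setoid X
  open Inverse (Bijection⇒Inverse ∣X∣)

  i : Fin (suc n)
  i = from x

  i≢from : ∀ {y} → ¬ (y ≈ x) → i ≢ from y
  i≢from {y} y≉x eq = y≉x (trans (sym (strictlyInverseˡ y))
                             (trans (to-cong (≡.sym eq)) (strictlyInverseˡ x)))

-- Cayley graphs of labelled groups

module _ (G : AbelianGroup a ℓ) where
  open AbelianGroup G
  open AbelianGroupProperties G
  open import Relation.Binary.Reasoning.Setoid setoid

  -‿cancelʳ : ∀ x y z → (x - z) - (y - z) ≈ x - y
  -‿cancelʳ x y z = begin
    (x - z) - (y - z)       ≈⟨ ∙-congˡ (⁻¹-anti-homo‿- y z) ⟩
    (x - z) ∙ (z - y)       ≈⟨ assoc (x - z) z (y ⁻¹) ⟨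
    ((x - z) ∙ z) ∙ y ⁻¹    ≈⟨ ∙-congʳ (//-rightDividesˡ z x) ⟩
    x - y                   ∎

  translate : ∀ x {P : Pred Carrier p} {Q : Pred Carrier s} →
              (∀ {t} → P t → Q (t ∙ x)) → (∀ {y} → Q y → P (y - x)) →
              Inverse (setoid ↾ P) (setoid ↾ Q)
  translate x = ↾-↔ (mkInverse setoid setoid (_∙ x) (_- x) ∙-congʳ ∙-congʳ
                               (//-rightDividesˡ x) (//-rightDividesʳ x))

  module _ {S : Pred Carrier p} (S-resp : S Respects _≈_) where

    neighbours : ∀ x → Inverse (setoid ↾ S) (setoid ↾ λ y → y - x ∈ S)
    neighbours x = translate x (S-resp (sym (//-rightDividesʳ x _))) id

    -- Subtracting `x` moves the pair to `ε` and `x′ - x`, so only the difference of the two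
    -- vertices matters.
    commonNeighbours : ∀ x x′ → Inverse (setoid ↾ λ t → t ∈ S × t - (x′ - x) ∈ S)
                                        (setoid ↾ λ y → y - x ∈ S × y - x′ ∈ S)
    commonNeighbours x x′ = translate x
      (λ {t} (t∈S , d∈S) → S-resp (sym (//-rightDividesʳ x t)) t∈S , S-resp (shift t) d∈S)
      (λ {y} (y-x∈S , y-x′∈S) → y-x∈S , S-resp (sym (-‿cancelʳ y x′ x)) y-x′∈S)
      where
      shift : ∀ t → t - (x′ - x) ≈ t ∙ x - x′
      shift t = begin
        t - (x′ - x)            ≈⟨ ∙-congʳ (//-rightDividesʳ x t) ⟨
        (t ∙ x - x) - (x′ - x)  ≈⟨ -‿cancelʳ (t ∙ x) x′ x ⟩
        t ∙ x - x′              ∎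

module _ (A : AbelianGroup 0ℓ 0ℓ) (H : AbelianGroup b ℓ) where

  private
    module A = AbelianGroup A
    module H = AbelianGroup H
    module Aᵖ = AbelianGroupProperties A
    module Hᵖ = AbelianGroupProperties H
    G : AbelianGroup b ℓ
    G = A ⊕ H
    module G = AbelianGroup G

  -- The relation is the graph of a function H ∖ {ε} → A ∖ {ε} with values of order two.
  record IsLabelling (_▷_ : A.Carrier → H.Carrier → Set p) : Set (b Level.⊔ ℓ Level.⊔ p) where
    field
      resp        : ∀ {a a′ x x′} → a A.≈ a′ → x H.≈ x′ → a ▷ x → a′ ▷ x′
      label       : ∀ {x} → ¬ (x H.≈ H.ε) → ∃[ a ] a ▷ x
      unique      : ∀ {a a′ x} → a ▷ x → a′ ▷ x → a A.≈ a′
      label≉ε     : ∀ {a x} → a ▷ x → ¬ (a A.≈ A.ε)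
      support     : ∀ {a x} → a ▷ x → ¬ (x H.≈ H.ε)
      involutive  : ∀ {a x} → a ▷ x → a A.∙ a A.≈ A.ε
      symmetric   : ∀ {a x} → a ▷ x → a ▷ (x H.⁻¹)

  -- Fixing `S` only up to `≐` lets the results apply directly to the connection set of the
  -- construction, whose definition has a different shape.
  module Labelled {_▷_ : A.Carrier → H.Carrier → Set p} (isLabelling : IsLabelling _▷_)
                  {S : Pred G.Carrier s}
                  (S≐ : S ≐ ((λ (a , x) → x H.≈ H.ε × ¬ (a A.≈ A.ε)) ∪ λ (a , x) → a ▷ x))
                  where
    open IsLabelling isLabelling

    Γ : Graph b ℓ s
    Γ = Cay G S

    open Graph Γ using (_~_)

    private
      Horizontal : Pred G.Carrier ℓ
      Horizontal (a , x) = x H.≈ H.ε × ¬ (a A.≈ A.ε)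

      Oblique : Pred G.Carrier p
      Oblique (a , x) = a ▷ x

      S⇒ : S ⊆ Horizontal ∪ Oblique
      S⇒ = proj₁ S≐

      ⇒S : Horizontal ∪ Oblique ⊆ S
      ⇒S = proj₂ S≐

    unique-≈ : ∀ {a a′ x x′} → x H.≈ x′ → a ▷ x → a′ ▷ x′ → a A.≈ a′
    unique-≈ eq ax a′x′ = unique (resp A.refl eq ax) a′x′

    S-resp : S Respects G._≈_
    S-resp (a≈ , x≈) = ⇒S ∘ Sum.map (λ (x≈ε , a≉ε) → H.trans (H.sym x≈) x≈ε , a≉ε ∘ A.trans a≈)
                                    (resp a≈ x≈) ∘ S⇒

    S-⁻¹ : ∀ {g} → g ∈ S → g G.⁻¹ ∈ S
    S-⁻¹ {a , x} = ⇒S ∘ Sum.map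
      (λ (x≈ε , a≉ε) → H.trans (H.⁻¹-cong x≈ε) Hᵖ.ε⁻¹≈ε
                      , λ eq → a≉ε (Aᵖ.⁻¹-injective (A.trans eq (A.sym Aᵖ.ε⁻¹≈ε))))
      -- An element of order two is its own inverse, and `symmetric` gives `x ⁻¹` the same label as
      -- `x`.
      (λ ax → resp (Aᵖ.inverseˡ-unique a a (involutive ax)) H.refl (symmetric ax)) ∘ S⇒

    ε∉S : ∀ {g} → g G.≈ G.ε → ¬ (g ∈ S)
    ε∉S (a≈ε , x≈ε) = [ (λ (_ , a≉ε) → a≉ε a≈ε) , (λ ax → support ax x≈ε) ]′ ∘ S⇒

    isSimple : IsSimple Γ
    isSimple = record
      { ~-resp-≈ = (λ eq → S-resp (G.∙-congʳ eq))
                 , (λ eq → S-resp (G.∙-congˡ (G.⁻¹-cong eq)))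
      ; ~-sym    = λ {x} {y} x~y → S-resp (AbelianGroupProperties.⁻¹-anti-homo‿- G y x) (S-⁻¹ x~y)
      ; loopless = λ {x} → ε∉S (G.inverseʳ x)
      }

    horizontal : (P : Pred A.Carrier t) →
                 Inverse (A.setoid ↾ P) (G.setoid ↾ λ (a , x) → x H.≈ H.ε × P a)
    horizontal P = mkInverse _ _
      (λ (a , pa) → (a , H.ε) , H.refl , pa) (λ ((a , x) , x≈ε , pa) → a , pa)
      (λ eq → eq , H.refl) proj₁
      (λ (_ , x≈ε , _) → A.refl , H.sym x≈ε) (λ _ → A.refl)

    -- Uniqueness of labels makes an oblique element determined by its `H` component, so oblique
    -- elements can be counted inside `H`.
    oblique : (P : Pred G.Carrier t) →
              Inverse (H.setoid ↾ λ x → ∃[ a ] a ▷ x × P (a , x))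
                      (G.setoid ↾ λ (a , x) → a ▷ x × P (a , x))
    oblique P = mkInverse _ _
      (λ (x , a , q) → (a , x) , q) (λ ((a , x) , q) → x , a , q)
      (λ {(_ , _ , ax , _)} {(_ , _ , a′x′ , _)} eq → unique-≈ eq ax a′x′ , eq) proj₂
      (λ _ → G.refl) (λ _ → H.refl)

    module _ {n q} (∣A∣ : ∣ A.setoid ∣≡ n) (∣H∣ : ∣ H.setoid ∣≡ q) where

      -- The horizontal part is a copy of `A` without `ε`; by `label` and `support`, the oblique
      -- part is a copy of `H` without `ε`.
      degree : ∀ x → ∣ G.setoid ↾ (x ~_) ∣≡ (n ∸ 1) ℕ.+ (q ∸ 1)
      degree x = ∣∣-resp-↔ (neighbours G S-resp x)
        (↾-≐ ((⇒S ∘ Sum.map₂ proj₁) , (Sum.map₂ (λ ax → ax , support ax) ∘ S⇒))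
          (∣∪∣ G.setoid (λ (x≈ε , _) (ay , _) (_ , x≈y) → support ay (H.trans (H.sym x≈y) x≈ε))
            (∣∣-resp-↔ (horizontal _) (∣≉∣ A.setoid A.ε ∣A∣))
            (∣∣-resp-↔ (oblique _) (↾-≐ ((λ x≉ε → let a , ax = label x≉ε in a , ax , support ax)
                                        , λ (_ , ax , _) → support ax)
                                       (∣≉∣ H.setoid H.ε ∣H∣)))))

      -- Since `x ≈ ε`, subtracting `(g , x)` fixes the `H` component, so `t` and the difference are
      -- of the same kind. The horizontal solutions are `A` with the two distinct points `ε` and `g`
      -- removed.
      horizontalEdge : ∀ {g x} → x H.≈ H.ε → ¬ (g A.≈ A.ε) →
                       ∣ G.setoid ↾ (λ t → t ∈ S × t G.- (g , x) ∈ S) ∣≡ n ∸ 2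
      horizontalEdge {g} {x} x≈ε g≉ε = ∣∣-resp-≡ (ℕ.∸-+-assoc n 1 1)
        (↾-≐ (to , from)
        (∣∣-resp-↔ (horizontal (λ a → ¬ (a A.≈ A.ε) × ¬ (a A.≈ g)))
        (∣∣-resp-↔ flatten
          (∣≉∣ (A.setoid ↾ λ a → ¬ (a A.≈ A.ε)) (g , g≉ε) (∣≉∣ A.setoid A.ε ∣A∣)))))
        where
        flatten = mkInverse ((A.setoid ↾ λ a → ¬ (a A.≈ A.ε)) ↾ λ (a , _) → ¬ (a A.≈ g))
                            (A.setoid ↾ λ a → ¬ (a A.≈ A.ε) × ¬ (a A.≈ g))
          (λ ((a , a≉ε) , a≉g) → a , a≉ε , a≉g) (λ (a , a≉ε , a≉g) → (a , a≉ε) , a≉g)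
          id id (λ _ → A.refl) (λ _ → A.refl)

        -x≈ε : ∀ y → y H.- x H.≈ y
        -x≈ε y = H.trans (H.∙-congˡ (H.trans (H.⁻¹-cong x≈ε) Hᵖ.ε⁻¹≈ε)) (H.identityʳ y)

        -g≉ : ∀ {a} → ¬ (a A.- g A.≈ a)
        -g≉ {a} eq = g≉ε (Aᵖ.⁻¹-injective (A.trans
          (Aᵖ.∙-cancelˡ a (g A.⁻¹) A.ε (A.trans eq (A.sym (A.identityʳ a)))) (A.sym Aᵖ.ε⁻¹≈ε)))

        Common : Pred G.Carrier ℓ
        Common (a , y) = y H.≈ H.ε × ¬ (a A.≈ A.ε) × ¬ (a A.≈ g)

        to : ∀ {t} → Common t → t ∈ S × t G.- (g , x) ∈ S
        to {a , y} (y≈ε , a≉ε , a≉g) =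
          ⇒S (inj₁ (y≈ε , a≉ε)) ,
          ⇒S (inj₁ (H.trans (-x≈ε y) y≈ε , a≉g ∘ Aᵖ.x∙y⁻¹≈ε⇒x≈y a g))

        from : ∀ {t} → t ∈ S × t G.- (g , x) ∈ S → Common t
        from {a , y} (t∈S , d∈S) with S⇒ t∈S | S⇒ d∈S
        ... | inj₁ (y≈ε , a≉ε) | inj₁ (_ , a-g≉ε) = y≈ε , a≉ε , a-g≉ε ∘ Aᵖ.x≈y⇒x∙y⁻¹≈ε
        ... | inj₁ (y≈ε , _)   | inj₂ ad = contradiction (H.trans (-x≈ε y) y≈ε) (support ad)
        ... | inj₂ ay          | inj₁ (d≈ε , _) =
              contradiction (H.trans (H.sym (-x≈ε y)) d≈ε) (support ay)
        -- Both labels belong to the same `y`, so `a - g ≈ a`, which forces `g ≈ ε`.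
        ... | inj₂ ay          | inj₂ ad = contradiction (unique-≈ (-x≈ε y) ad ay) -g≉

      -- Only pairs of oblique elements survive. Two horizontal ones would force `x ≈ ε`; a single
      -- one would put `y` at `ε` or at `x`, and uniqueness of labels then makes the horizontal
      -- element `ε` itself.
      obliqueEdge : ∀ {g x} → g ▷ x → ∀ {m} →
                    ∣ H.setoid ↾ (λ y → ∃[ a ] a ▷ y × (a A.- g) ▷ (y H.- x)) ∣≡ m →
                    ∣ G.setoid ↾ (λ t → t ∈ S × t G.- (g , x) ∈ S) ∣≡ m
      obliqueEdge {g} {x} gx count = ↾-≐ (to , from) (∣∣-resp-↔ (oblique _) count)
        where
        g-g≈ε : ∀ {a} → a A.≈ g → a A.- g A.≈ A.ε
        g-g≈ε = Aᵖ.x≈y⇒x∙y⁻¹≈ε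

        Common : Pred G.Carrier p
        Common (a , y) = a ▷ y × (a A.- g) ▷ (y H.- x)

        to : ∀ {t} → Common t → t ∈ S × t G.- (g , x) ∈ S
        to (ay , ad) = ⇒S (inj₂ ay) , ⇒S (inj₂ ad)

        from : ∀ {t} → t ∈ S × t G.- (g , x) ∈ S → Common t
        from {a , y} (t∈S , d∈S) with S⇒ t∈S | S⇒ d∈S
        ... | inj₂ ay          | inj₂ ad = ay , ad
        ... | inj₂ ay          | inj₁ (y-x≈ε , a-g≉ε) =
              contradiction (g-g≈ε (unique-≈ (Hᵖ.x∙y⁻¹≈ε⇒x≈y y x y-x≈ε) ay gx)) a-g≉ε
        ... | inj₁ (y≈ε , _)   | inj₁ (y-x≈ε , _) =
              contradiction (H.trans (H.sym (Hᵖ.x∙y⁻¹≈ε⇒x≈y y x y-x≈ε)) y≈ε) (support gx)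
        -- Here y - x ≈ - x has label g, so a - g ≈ g and a ≈ g ∙ g ≈ ε.
        ... | inj₁ (y≈ε , a≉ε) | inj₂ ad = contradiction
              (A.trans (A.sym (Aᵖ.//-rightDividesˡ g a))
                (A.trans (A.∙-congʳ (unique-≈ (H.trans (H.∙-congʳ y≈ε) (H.identityˡ _)) ad
                                              (symmetric gx)))
                         (involutive gx)))
              a≉ε

      order : ∣ G.setoid ∣≡ n ℕ.* q
      order = ∣×∣ ∣A∣ ∣H∣

      isEdgeRegular : ∃[ x ] (¬ (x H.≈ H.ε)) →
        (∀ {g x} → g ▷ x →
          ∣ H.setoid ↾ (λ y → ∃[ a ] a ▷ y × (a A.- g) ▷ (y H.- x)) ∣≡ n ∸ 2) →
        IsEdgeRegular Γ (n ℕ.* q) (n ∸ 2 ℕ.+ q) (n ∸ 2)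
      isEdgeRegular (x , x≉ε) obliqueCount = record
        { isSimple = isSimple
        ; nonEmpty = G.ε , (e , x) , S-resp
            (G.sym (G.trans (G.∙-congˡ (AbelianGroupProperties.ε⁻¹≈ε G)) (G.identityʳ (e , x))))
            (⇒S (inj₂ ex))
        ; order = order
        ; regular = λ v → ∣∣-resp-≡ (degree≡ ∣A∣ ∣H∣) (degree v)
        ; commonNeighbours = λ u v u~v → ∣∣-resp-↔ (commonNeighbours G S-resp u v)
            ([ (λ (x≈ε , g≉ε) → horizontalEdge x≈ε g≉ε) , (λ gx → obliqueEdge gx (obliqueCount gx)) ]′
              (S⇒ u~v))
        }
        where
        e : A.Carrier
        e = proj₁ (label x≉ε)

        ex : e ▷ x
        ex = proj₂ (label x≉ε)

        -- With truncated subtraction the identity requires `n` at least 2 and `q` at least 1.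
        -- Indeed `ε` and `e` are distinct in `A`, and `H` contains `ε`.
        degree≡ : ∀ {n q} → ∣ A.setoid ∣≡ n → ∣ H.setoid ∣≡ q → (n ∸ 1) ℕ.+ (q ∸ 1) ≡ n ∸ 2 ℕ.+ q
        degree≡ {zero}        ∣A∣ _   = inhabited-∣∣≡0 A.ε ∣A∣
        degree≡ {suc zero}    ∣A∣ _   =
          inhabited-∣∣≡0 (e , label≉ε ex) (∣≉∣ A.setoid A.ε ∣A∣)
        degree≡ {suc (suc _)} {zero} _ ∣H∣ = inhabited-∣∣≡0 H.ε ∣H∣
        degree≡ {suc (suc n)} {suc q} _ _ = ≡.sym (ℕ.+-suc n q)

      hasRegularClique : HasRegularCliqueOfOrder Γ n
      hasRegularClique = 𝒞 , record
        { isClique = record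
          { resp-≈   = λ (_ , x≈y) x≈ε → H.trans (H.sym x≈y) x≈ε
          ; adjacent = λ {(a , x)} {(b , y)} x≈ε y≈ε g≉h → ⇒S (inj₁
              ( Hᵖ.x≈y⇒x∙y⁻¹≈ε (H.trans y≈ε (H.sym x≈ε))
              , λ eq → g≉h (A.sym (Aᵖ.x∙y⁻¹≈ε⇒x≈y b a eq) , H.trans x≈ε (H.sym y≈ε))))
          }
        ; nexus = 1
        ; nexus>0 = ℕ.≤-refl
        ; regular = nexus
        } , ∣∣-resp-↔ layer ∣A∣
        where
        𝒞 : Pred G.Carrier ℓ
        𝒞 (_ , x) = x H.≈ H.ε

        layer : Inverse A.setoid (G.setoid ↾ 𝒞)
        layer = mkInverse _ _ (λ a → (a , H.ε) , H.refl) (λ ((a , _) , _) → a)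
          (λ eq → eq , H.refl) proj₁ (λ (_ , x≈ε) → A.refl , H.sym x≈ε) (λ _ → A.refl)

        ε-x : ∀ {x y} → y H.≈ H.ε → y H.- x H.≈ x H.⁻¹
        ε-x y≈ε = H.trans (H.∙-congʳ y≈ε) (H.identityˡ _)

        nexus : ∀ v → ¬ 𝒞 v → ∣ G.setoid ↾ (λ w → v ~ w × 𝒞 w) ∣≡ 1
        nexus (a , x) x≉ε = Inverse⇒Bijection (mkInverse (≡.setoid (Fin 1)) _
          (λ _ → (e A.∙ a , H.ε)
               , ⇒S (inj₂ (resp (A.sym (Aᵖ.//-rightDividesʳ a e)) (H.sym (ε-x H.refl)) ex))
               , H.refl)
          (λ _ → Fin.zero) (λ _ → G.refl) (λ _ → ≡.refl)
          (λ ((c , y) , x~y , y≈ε) → e∙a≈c c y (S⇒ x~y) y≈ε , H.sym y≈ε)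
          (λ where Fin.zero → ≡.refl))
          where
          e : A.Carrier
          e = proj₁ (label x≉ε)

          -- The difference from `(a , x)` to a vertex of `𝒞` has `H` component `x ⁻¹`, which shares
          -- its label with `x`.
          ex : e ▷ (x H.⁻¹)
          ex = symmetric (proj₂ (label x≉ε))

          e∙a≈c : ∀ c y → (Horizontal ∪ Oblique) (c A.- a , y H.- x) → y H.≈ H.ε →
                  e A.∙ a A.≈ c
          e∙a≈c c y (inj₁ (y-x≈ε , _)) y≈ε =
            contradiction (H.trans (H.sym (Hᵖ.x∙y⁻¹≈ε⇒x≈y y x y-x≈ε)) y≈ε) x≉ε
          e∙a≈c c y (inj₂ cd) y≈ε =
            A.trans (A.∙-congʳ (unique-≈ (H.sym (ε-x y≈ε)) ex cd)) (Aᵖ.//-rightDividesˡ a c)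

-- Residues and powers of a primitive element

module ℤ/ (n : ℕ) = AbelianGroup (ℤ/ n)

≡⇒≡mod : ∀ n {i j} → i ≡ j → i ≡ j [mod n ]
≡⇒≡mod n = ℤ/.reflexive n

module _ (n : ℕ) .{{_ : ℕ.NonZero n}} where

  %ℕ-≡mod : ∀ i → + (i %ℕ n) ≡ i [mod n ]
  %ℕ-≡mod i = ℤ/.sym n (mod (divides (i /ℕ n)
    (≡.trans (≡.cong (ℤ._- + (i %ℕ n)) (a≡a%ℕn+[a/ℕn]*n i n)) (cancel (+ (i %ℕ n)) _))))
    where
    cancel : ∀ x y → (x ℤ.+ y) ℤ.- x ≡ y
    cancel = solve-∀

  -- The difference has absolute value below `n`, and the only such multiple of `n` is zero.
  residue-unique : ∀ {i j} → i < n → j < n → + i ≡ + j [mod n ] → i ≡ j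
  residue-unique {i} {j} i<n j<n (mod n∣i-j) = ℤ.+-injective
    (ℤ.i-j≡0⇒i≡j (+ i) (+ j) (ℤ.∣i∣≡0⇒i≡0 (multiple<⇒≡0 (∣⇒∣ᵤ n∣i-j)
      (ℕ.≤-<-trans (ℕ.≤-reflexive (≡.cong ℤ.∣_∣ (ℤ.m-n≡m⊖n i j)))
        (ℕ.≤-<-trans (ℤ.∣m⊝n∣≤m⊔n i j) (ℕ.⊔-lub i<n j<n))))))
    where
    multiple<⇒≡0 : ∀ {k} → n ℕ.∣ k → k < n → k ≡ 0
    multiple<⇒≡0 {zero}  _   _   = ≡.refl
    multiple<⇒≡0 {suc _} n∣k k<n = contradiction (ℕ.∣⇒≤ n∣k) (ℕ.<⇒≱ k<n)

  ∣ℤ/∣ : ∣ AbelianGroup.setoid (ℤ/ n) ∣≡ n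
  ∣ℤ/∣ = Inverse⇒Bijection (mkInverse (≡.setoid (Fin n)) (AbelianGroup.setoid (ℤ/ n))
    (λ k → + toℕ k) index
    (λ where ≡.refl → ℤ/.refl n)
    (λ {i} {j} i≡j → Fin.toℕ-injective (residue-unique (Fin.toℕ<n (index i)) (Fin.toℕ<n (index j))
      (ℤ/.trans n (index-≡mod i) (ℤ/.trans n i≡j (ℤ/.sym n (index-≡mod j))))))
    index-≡mod
    (λ k → Fin.toℕ-injective (residue-unique (Fin.toℕ<n (index (+ toℕ k))) (Fin.toℕ<n k)
      (index-≡mod (+ toℕ k)))))
    where
    index : ℤ → Fin n
    index i = fromℕ< (n%ℕd<d i n)

    index-≡mod : ∀ i → + toℕ (index i) ≡ i [mod n ]
    index-≡mod i = ≡.subst (λ k → + k ≡ i [mod n ])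
                     (≡.sym (Fin.toℕ-fromℕ< (n%ℕd<d i n))) (%ℕ-≡mod i)

-- Integer powers in a field

module FieldProperties (F : Field a ℓ) where
  open Field F
  open RingProperties ring
  open import Relation.Binary.Reasoning.Setoid setoid

  x⁻¹*[x*y]≈y : ∀ {x} → ¬ (x ≈ 0#) → ∀ y → x ⁻¹ * (x * y) ≈ y
  x⁻¹*[x*y]≈y {x} x≉0 y = begin
    x ⁻¹ * (x * y)  ≈⟨ *-assoc (x ⁻¹) x y ⟨
    (x ⁻¹ * x) * y  ≈⟨ *-congʳ (trans (*-comm (x ⁻¹) x) (*-inverseʳ x x≉0)) ⟩
    1# * y          ≈⟨ *-identityˡ y ⟩
    y               ∎

  x*[x⁻¹*y]≈y : ∀ {x} → ¬ (x ≈ 0#) → ∀ y → x * (x ⁻¹ * y) ≈ y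
  x*[x⁻¹*y]≈y {x} x≉0 y = begin
    x * (x ⁻¹ * y)  ≈⟨ *-assoc x (x ⁻¹) y ⟨
    (x * x ⁻¹) * y  ≈⟨ *-congʳ (*-inverseʳ x x≉0) ⟩
    1# * y          ≈⟨ *-identityˡ y ⟩
    y               ∎

  *-cancelˡ-nonZero : ∀ {x y z} → ¬ (x ≈ 0#) → x * y ≈ x * z → y ≈ z
  *-cancelˡ-nonZero {x} {y} {z} x≉0 eq =
    trans (sym (x⁻¹*[x*y]≈y x≉0 y)) (trans (*-congˡ eq) (x⁻¹*[x*y]≈y x≉0 z))

module Powers (F : Field a ℓ) {ρ : Field.Carrier F} (ρ≉0 : ¬ (Field._≈_ F ρ (Field.0# F))) where
  open Field F
  open Cyclotomy F
  open FieldProperties F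
  open RingProperties ring
  open import Relation.Binary.Reasoning.Setoid setoid

  ^ᶻ-suc : ∀ i → ρ ^ᶻ (1ℤ ℤ.+ i) ≈ ρ * ρ ^ᶻ i
  ^ᶻ-suc (+ n)          = refl
  ^ᶻ-suc -[1+ zero ]    = sym (x*[x⁻¹*y]≈y ρ≉0 1#)
  ^ᶻ-suc -[1+ (suc n) ] = sym (x*[x⁻¹*y]≈y ρ≉0 _)

  ^ᶻ-pred : ∀ i → ρ ^ᶻ (-1ℤ ℤ.+ i) ≈ ρ ⁻¹ * ρ ^ᶻ i
  ^ᶻ-pred (+ zero)  = refl
  ^ᶻ-pred (+ suc n) = sym (x⁻¹*[x*y]≈y ρ≉0 _)
  ^ᶻ-pred -[1+ n ]  = refl

  -- Induction on `i` away from zero in unit steps, so that the sign split of `_^ᶻ_` is met only in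
  -- `^ᶻ-suc` and `^ᶻ-pred`.
  ^ᶻ-homo-* : ∀ i j → ρ ^ᶻ (i ℤ.+ j) ≈ ρ ^ᶻ i * ρ ^ᶻ j
  ^ᶻ-homo-* (+ zero) j = begin
    ρ ^ᶻ (0ℤ ℤ.+ j)  ≡⟨ ≡.cong (ρ ^ᶻ_) (ℤ.+-identityˡ j) ⟩
    ρ ^ᶻ j           ≈⟨ *-identityˡ _ ⟨
    1# * ρ ^ᶻ j      ∎
  ^ᶻ-homo-* (+ suc n) j = begin
    ρ ^ᶻ (+ suc n ℤ.+ j)         ≡⟨ ≡.cong (ρ ^ᶻ_) (ℤ.+-assoc 1ℤ (+ n) j) ⟩
    ρ ^ᶻ (1ℤ ℤ.+ (+ n ℤ.+ j))    ≈⟨ ^ᶻ-suc (+ n ℤ.+ j) ⟩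
    ρ * ρ ^ᶻ (+ n ℤ.+ j)         ≈⟨ *-congˡ (^ᶻ-homo-* (+ n) j) ⟩
    ρ * (ρ ^ᶻ (+ n) * ρ ^ᶻ j)    ≈⟨ *-assoc ρ _ _ ⟨
    ρ ^ᶻ (+ suc n) * ρ ^ᶻ j      ∎
  ^ᶻ-homo-* -[1+ zero ] j = begin
    ρ ^ᶻ (-1ℤ ℤ.+ j)             ≈⟨ ^ᶻ-pred j ⟩
    ρ ⁻¹ * ρ ^ᶻ j                ≈⟨ *-congʳ (*-identityʳ (ρ ⁻¹)) ⟨
    ρ ^ᶻ -1ℤ * ρ ^ᶻ j            ∎
  ^ᶻ-homo-* -[1+ suc n ] j = begin
    ρ ^ᶻ (-[1+ suc n ] ℤ.+ j)       ≡⟨ ≡.cong (ρ ^ᶻ_) (ℤ.+-assoc -1ℤ -[1+ n ] j) ⟩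
    ρ ^ᶻ (-1ℤ ℤ.+ (-[1+ n ] ℤ.+ j)) ≈⟨ ^ᶻ-pred (-[1+ n ] ℤ.+ j) ⟩
    ρ ⁻¹ * ρ ^ᶻ (-[1+ n ] ℤ.+ j)    ≈⟨ *-congˡ (^ᶻ-homo-* -[1+ n ] j) ⟩
    ρ ⁻¹ * (ρ ^ᶻ -[1+ n ] * ρ ^ᶻ j) ≈⟨ *-assoc (ρ ⁻¹) _ _ ⟨
    ρ ^ᶻ -[1+ suc n ] * ρ ^ᶻ j      ∎

  ^ᶻ-inverseʳ : ∀ i → ρ ^ᶻ i * ρ ^ᶻ (ℤ.- i) ≈ 1#
  ^ᶻ-inverseʳ i = trans (sym (^ᶻ-homo-* i (ℤ.- i))) (reflexive (≡.cong (ρ ^ᶻ_) (ℤ.+-inverseʳ i)))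

  ^ᶻ≉0 : ∀ i → ¬ (ρ ^ᶻ i ≈ 0#)
  ^ᶻ≉0 i eq = 1≉0 (trans (sym (^ᶻ-inverseʳ i)) (trans (*-congʳ eq) (zeroˡ _)))

  ^ᶻ-multiple : ∀ {i} → ρ ^ᶻ i ≈ 1# → ∀ k → ρ ^ᶻ (k ℤ.* i) ≈ 1#
  ^ᶻ-multiple {i} period = multiple
    where
    natural : ∀ n → ρ ^ᶻ (+ n ℤ.* i) ≈ 1#
    natural zero    = refl
    natural (suc n) = begin
      ρ ^ᶻ (+ suc n ℤ.* i)       ≡⟨ ≡.cong (ρ ^ᶻ_) (ℤ.suc-* (+ n) i) ⟩
      ρ ^ᶻ (i ℤ.+ + n ℤ.* i)     ≈⟨ ^ᶻ-homo-* i (+ n ℤ.* i) ⟩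
      ρ ^ᶻ i * ρ ^ᶻ (+ n ℤ.* i)  ≈⟨ *-cong period (natural n) ⟩
      1# * 1#                    ≈⟨ *-identityˡ 1# ⟩
      1#                         ∎

    multiple : ∀ k → ρ ^ᶻ (k ℤ.* i) ≈ 1#
    multiple (+ n)    = natural n
    multiple -[1+ n ] = begin
      ρ ^ᶻ (-[1+ n ] ℤ.* i)      ≡⟨ ≡.cong (ρ ^ᶻ_) (ℤ.neg-distribˡ-* (+ suc n) i) ⟨
      ρ ^ᶻ (ℤ.- j)               ≈⟨ *-identityˡ _ ⟨
      1# * ρ ^ᶻ (ℤ.- j)          ≈⟨ *-congʳ (natural (suc n)) ⟨
      ρ ^ᶻ j * ρ ^ᶻ (ℤ.- j)      ≈⟨ ^ᶻ-inverseʳ j ⟩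
      1#                         ∎
      where
      j : ℤ
      j = + suc n ℤ.* i

  -- Any period `d` is allowed, because `order≤period` applies this before the order of `ρ` is
  -- known.
  ^ᶻ-≡mod : ∀ {d} → ρ ^ᶻ (+ d) ≈ 1# → ∀ {i j} → i ≡ j [mod d ] → ρ ^ᶻ i ≈ ρ ^ᶻ j
  ^ᶻ-≡mod {d} period {i} {j} (mod (divides k i-j≡k*d)) = begin
    ρ ^ᶻ i                          ≡⟨ ≡.cong (ρ ^ᶻ_) (split i j) ⟩
    ρ ^ᶻ ((i ℤ.- j) ℤ.+ j)          ≈⟨ ^ᶻ-homo-* (i ℤ.- j) j ⟩
    ρ ^ᶻ (i ℤ.- j) * ρ ^ᶻ j         ≡⟨ ≡.cong (λ k → ρ ^ᶻ k * ρ ^ᶻ j) i-j≡k*d ⟩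
    ρ ^ᶻ (k ℤ.* + d) * ρ ^ᶻ j       ≈⟨ *-congʳ (^ᶻ-multiple {+ d} period k) ⟩
    1# * ρ ^ᶻ j                     ≈⟨ *-identityˡ _ ⟩
    ρ ^ᶻ j                          ∎
    where
    split : ∀ i j → i ≡ (i ℤ.- j) ℤ.+ j
    split = solve-∀

  ^ᶻ-difference : ∀ i j → ρ ^ᶻ i ≈ ρ ^ᶻ j → ρ ^ᶻ (i ℤ.- j) ≈ 1#
  ^ᶻ-difference i j eq = trans (^ᶻ-homo-* i (ℤ.- j)) (trans (*-congʳ eq) (^ᶻ-inverseʳ j))

-- Order of a primitive element

module Order (F : Field a ℓ) {ρ : Field.Carrier F} (isPrimitive : Cyclotomy.IsPrimitive F ρ)
             {N : ℕ} (∣F*∣ : ∣ Field.+-abelianGroup F * ∣≡ N) where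
  open Field F
  open Cyclotomy F
  open Powers F (proj₁ isPrimitive)
  open Inverse (Bijection⇒Inverse ∣F*∣) using (to; from; to-cong; from-cong; strictlyInverseˡ; strictlyInverseʳ)

  -- A positive period d makes the discrete logarithm an injection F* → ℤ/d.
  order≤period : ∀ d → 0 < d → ρ ^ᶻ (+ d) ≈ 1# → N ≤ d
  order≤period d@(suc _) _ period = Fin.injective⇒≤ {f = residue} λ {k} {k′} eq →
    ≡.trans (≡.sym (strictlyInverseʳ k)) (≡.trans (from-cong
      (trans (log-≈ k) (trans (^ᶻ-≡mod period (cong-residue eq)) (sym (log-≈ k′)))))
      (strictlyInverseʳ k′))
    where
    log : Fin N → ℤ
    log k = proj₁ (proj₂ isPrimitive (proj₁ (to k)) (proj₂ (to k)))

    log-≈ : ∀ k → proj₁ (to k) ≈ ρ ^ᶻ log k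
    log-≈ k = proj₂ (proj₂ isPrimitive (proj₁ (to k)) (proj₂ (to k)))

    open Inverse (Bijection⇒Inverse (∣ℤ/∣ d)) renaming (from to index) using ()

    residue : Fin N → Fin d
    residue k = index (log k)

    cong-residue : ∀ {k k′} → residue k ≡ residue k′ → log k ≡ log k′ [mod d ]
    cong-residue {k} {k′} eq =
      ℤ/.trans d (ℤ/.sym d (I.strictlyInverseˡ (log k)))
        (ℤ/.trans d (I.to-cong eq) (I.strictlyInverseˡ (log k′)))
      where module I = Inverse (Bijection⇒Inverse (∣ℤ/∣ d))

  -- The `N + 1` powers with exponents from 0 to `N` lie among `N` nonzero elements, so two coincide
  -- and their exponents differ by a positive period of at most `N`. By `order≤period` it is exactly
  -- `N`.
  period : ρ ^ᶻ (+ N) ≈ 1#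
  period with i , j , i<j , fi≡fj ← Fin.pigeonhole {N} ℕ.≤-refl
                (λ k → from (ρ ^ᶻ (+ toℕ k) , ^ᶻ≉0 (+ toℕ k)))
    = ≡.subst (λ d → ρ ^ᶻ (+ d) ≈ 1#)
        (ℕ.≤-antisym (ℕ.≤-trans (ℕ.m∸n≤m (toℕ j) (toℕ i)) (ℕ.s≤s⁻¹ (Fin.toℕ<n j)))
                     (order≤period (toℕ j ∸ toℕ i) (ℕ.m<n⇒0<n∸m i<j) dPeriod))
        dPeriod
    where
    dPeriod : ρ ^ᶻ (+ (toℕ j ∸ toℕ i)) ≈ 1#
    dPeriod = ≡.subst (λ d → ρ ^ᶻ d ≈ 1#)
      (≡.trans (ℤ.m-n≡m⊖n (toℕ j) (toℕ i)) (ℤ.⊖-≥ (ℕ.<⇒≤ i<j)))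
      (^ᶻ-difference (+ toℕ j) (+ toℕ i) (trans (sym (strictlyInverseˡ _))
                       (trans (to-cong (≡.sym fi≡fj)) (strictlyInverseˡ _))))

  -- The residue of `i - j` modulo `N` is an exponent with power `1#`; were it positive, it would be
  -- a period smaller than `N`.
  ^ᶻ-injective : .{{_ : ℕ.NonZero N}} → ∀ {i j} → ρ ^ᶻ i ≈ ρ ^ᶻ j → i ≡ j [mod N ]
  ^ᶻ-injective {i} {j} eq = difference (ℤ/.sym N (%ℕ-≡mod N (i ℤ.- j))) (n%ℕd<d (i ℤ.- j) N)
    where
    difference : ∀ {t} → i ℤ.- j ≡ + t [mod N ] → t < N → i ≡ j [mod N ]
    difference {zero}  (mod N∣) _ = mod (≡.subst (+ N ∣_) (ℤ.+-identityʳ _) N∣)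
    difference {suc t} eq′ t<N = contradiction
      (order≤period (suc t) ℕ.z<s (trans (sym (^ᶻ-≡mod period eq′)) (^ᶻ-difference i j eq)))
      (ℕ.<⇒≱ t<N)

-- Cubic classes

mod3-cases : ∀ k i → i ≡ k [mod 3 ] ⊎ i ≡ k ℤ.+ + 1 [mod 3 ] ⊎ i ≡ k ℤ.+ + 2 [mod 3 ]
mod3-cases k i = cases (%ℕ-≡mod 3 (i ℤ.- k)) (n%ℕd<d (i ℤ.- k) 3)
  where
  shift : ∀ {t} → + t ≡ i ℤ.- k [mod 3 ] → i ≡ k ℤ.+ + t [mod 3 ]
  shift {t} eq = ℤ/.trans 3 (≡⇒≡mod 3 (regroup i k)) (ℤ/.∙-congˡ 3 {k} (ℤ/.sym 3 eq))
    where
    regroup : ∀ i k → i ≡ k ℤ.+ (i ℤ.- k)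
    regroup = solve-∀

  cases : ∀ {t} → + t ≡ i ℤ.- k [mod 3 ] → t < 3 →
          i ≡ k [mod 3 ] ⊎ i ≡ k ℤ.+ + 1 [mod 3 ] ⊎ i ≡ k ℤ.+ + 2 [mod 3 ]
  cases {0} eq _ = inj₁ (ℤ/.trans 3 (shift eq) (ℤ/.identityʳ 3 k))
  cases {1} eq _ = inj₂ (inj₁ (shift eq))
  cases {2} eq _ = inj₂ (inj₂ (shift eq))
  cases {suc (suc (suc _))} _ (ℕ.s≤s (ℕ.s≤s (ℕ.s≤s ())))

module _ (k : ℤ) where
  private
    apart : ∀ {s t} → s < 3 → t < 3 → s ≢ t → ¬ (k ℤ.+ + s ≡ k ℤ.+ + t [mod 3 ])
    apart {s} {t} s<3 t<3 s≢t (mod d) = s≢t (residue-unique 3 s<3 t<3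
      (mod (≡.subst (+ 3 ∣_) (cancel k (+ s) (+ t)) d)))
      where
      cancel : ∀ k s t → (k ℤ.+ s) ℤ.- (k ℤ.+ t) ≡ s ℤ.- t
      cancel = solve-∀

  k+1≢k : ¬ (k ℤ.+ + 1 ≡ k [mod 3 ])
  k+1≢k eq = apart {1} {0} (ℕ.s≤s (ℕ.s≤s ℕ.z≤n)) (ℕ.s≤s ℕ.z≤n) (λ ())
               (ℤ/.trans 3 eq (ℤ/.sym 3 (ℤ/.identityʳ 3 k)))

  k+2≢k : ¬ (k ℤ.+ + 2 ≡ k [mod 3 ])
  k+2≢k eq = apart {2} {0} ℕ.≤-refl (ℕ.s≤s ℕ.z≤n) (λ ())
               (ℤ/.trans 3 eq (ℤ/.sym 3 (ℤ/.identityʳ 3 k)))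

  k+1≢k+2 : ¬ (k ℤ.+ + 1 ≡ k ℤ.+ + 2 [mod 3 ])
  k+1≢k+2 = apart {1} {2} (ℕ.s≤s (ℕ.s≤s ℕ.z≤n)) ℕ.≤-refl (λ ())

mod6r⇒mod3 : ∀ r {i j} → i ≡ j [mod 6 ℕ.* r ] → i ≡ j [mod 3 ]
mod6r⇒mod3 r (mod d) = mod (ℤ.∣-trans (∣ᵤ⇒∣ (ℕ.divides (2 ℕ.* r) (eq r))) d)
  where
  eq : ∀ r → 6 ℕ.* r ≡ 2 ℕ.* r ℕ.* 3
  eq = ℕSolver.solve-∀

-- Here `m = 3 m - 2 m`, and 3 divides both terms.
2m≡0⇒m≡0 : ∀ {m} → m ℤ.+ m ≡ 0ℤ [mod 3 ] → m ≡ 0ℤ [mod 3 ]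
2m≡0⇒m≡0 {m} (mod d) = mod (≡.subst (+ 3 ∣_) (eq m) (ℤ.∣m∣n⇒∣m-n (divides m ≡.refl) d))
  where
  eq : ∀ m → m ℤ.* + 3 ℤ.- (m ℤ.+ m ℤ.- 0ℤ) ≡ m ℤ.- 0ℤ
  eq = solve-∀

-- Brings an exponent `m = 3 k + i` into the range required by `C³`: as 3 times `2 r` is the order
-- `6 r`, `k` may be replaced by its residue modulo `2 r`.
3t+i≡m[mod6r] : ∀ r {k m i t} → m ℤ.- i ≡ k ℤ.* + 3 → t ≡ k [mod 2 ℕ.* r ] →
                + 3 ℤ.* t ℤ.+ i ≡ m [mod 6 ℕ.* r ]
3t+i≡m[mod6r] r {k} {m} {i} {t} m-i≡k*3 (mod (divides s t-k≡s*2r)) = mod (divides s (begin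
  (+ 3 ℤ.* t ℤ.+ i) ℤ.- m       ≡⟨ regroup t i m ⟩
  + 3 ℤ.* t ℤ.- (m ℤ.- i)       ≡⟨ ≡.cong (λ z → + 3 ℤ.* t ℤ.- z) m-i≡k*3 ⟩
  + 3 ℤ.* t ℤ.- k ℤ.* + 3       ≡⟨ factor t k ⟩
  + 3 ℤ.* (t ℤ.- k)             ≡⟨ ≡.cong (+ 3 ℤ.*_) t-k≡s*2r ⟩
  + 3 ℤ.* (s ℤ.* + (2 ℕ.* r))   ≡⟨ ≡.cong (λ z → + 3 ℤ.* (s ℤ.* z)) (ℤ.pos-* 2 r) ⟩
  + 3 ℤ.* (s ℤ.* (+ 2 ℤ.* + r))  ≡⟨ collect s (+ r) ⟩
  s ℤ.* (+ 6 ℤ.* + r)           ≡⟨ ≡.cong (s ℤ.*_) (ℤ.pos-* 6 r) ⟨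
  s ℤ.* + (6 ℕ.* r)             ∎))
  where
  open ≡.≡-Reasoning

  regroup : ∀ t i m → (+ 3 ℤ.* t ℤ.+ i) ℤ.- m ≡ + 3 ℤ.* t ℤ.- (m ℤ.- i)
  regroup = solve-∀

  factor : ∀ t k → + 3 ℤ.* t ℤ.- k ℤ.* + 3 ≡ + 3 ℤ.* (t ℤ.- k)
  factor = solve-∀

  collect : ∀ s r → + 3 ℤ.* (s ℤ.* (+ 2 ℤ.* r)) ≡ s ℤ.* (+ 6 ℤ.* r)
  collect = solve-∀

module CubicClasses (F : Field a ℓ) {ρ : Field.Carrier F} (isPrimitive : Cyclotomy.IsPrimitive F ρ)
                    (r : ℕ) .{{_ : ℕ.NonZero r}}
                    (∣F*∣ : ∣ Field.+-abelianGroup F * ∣≡ 6 ℕ.* r) where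
  open Field F
  open Cyclotomy F
  open FieldProperties F
  open RingProperties ring
  open Powers F (proj₁ isPrimitive)
  open Order F isPrimitive ∣F*∣
  open import Relation.Binary.Reasoning.Setoid setoid

  private instance
    6r≢0 : ℕ.NonZero (6 ℕ.* r)
    6r≢0 = ℕ.m*n≢0 6 r

    2r≢0 : ℕ.NonZero (2 ℕ.* r)
    2r≢0 = ℕ.m*n≢0 2 r

  -- A coset of the nonzero cubes, described as in `S[_]`. Unlike in `C³` the exponent is unbounded,
  -- so products and inverses of classes need no reduction.
  Class : ℤ → Pred Carrier ℓ
  Class i x = ∃[ j ] j ≡ i [mod 3 ] × x ≈ ρ ^ᶻ j

  Class-resp : ∀ {i i′ x x′} → i ≡ i′ [mod 3 ] → x ≈ x′ → Class i x → Class i′ x′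
  Class-resp i≡i′ x≈x′ (j , j≡i , x≈) = j , ℤ/.trans 3 j≡i i≡i′ , trans (sym x≈x′) x≈

  Class-nonZero : ∀ {i x} → Class i x → ¬ (x ≈ 0#)
  Class-nonZero (j , _ , x≈) x≈0 = ^ᶻ≉0 j (trans (sym x≈) x≈0)

  Class-total : ∀ {x} → ¬ (x ≈ 0#) → ∃[ i ] Class i x
  Class-total {x} x≉0 = let j , x≈ = proj₂ isPrimitive x x≉0 in j , j , ℤ/.refl 3 , x≈

  -- Exponents of equal powers agree modulo the order `6 r`, hence modulo 3.
  Class-unique : ∀ {i i′ x} → Class i x → Class i′ x → i ≡ i′ [mod 3 ]
  Class-unique (j , j≡i , x≈) (j′ , j′≡i′ , x≈′) = ℤ/.trans 3 (ℤ/.sym 3 j≡i)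
    (ℤ/.trans 3 (mod6r⇒mod3 r (^ᶻ-injective {j} {j′} (trans (sym x≈) x≈′))) j′≡i′)

  Class-* : ∀ {i i′ x x′} → Class i x → Class i′ x′ → Class (i ℤ.+ i′) (x * x′)
  Class-* (j , j≡i , x≈) (j′ , j′≡i′ , x′≈) =
    j ℤ.+ j′ , ℤ/.∙-cong 3 j≡i j′≡i′ , trans (*-cong x≈ x′≈) (sym (^ᶻ-homo-* j j′))

  Class-⁻¹ : ∀ {i x} → Class i x → Class (ℤ.- i) (x ⁻¹)
  Class-⁻¹ {i} {x} Cx@(j , j≡i , x≈) = ℤ.- j , ℤ/.⁻¹-cong 3 j≡i ,
    *-cancelˡ-nonZero x≉0 (trans (*-inverseʳ x x≉0)
      (sym (trans (*-congʳ x≈) (^ᶻ-inverseʳ j))))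
    where
    x≉0 : ¬ (x ≈ 0#)
    x≉0 = Class-nonZero Cx

  -- If - 1# ≈ ρ ^ᶻ m then 6 r ∣ 2 m.
  -1∈Class0 : Class 0ℤ (- 1#)
  -1∈Class0 with m , -1≈ ← proj₂ isPrimitive (- 1#)
                  (λ eq → 1≉0 (trans (sym (-‿involutive 1#)) (trans (-‿cong eq) -0#≈0#)))
    = m , 2m≡0⇒m≡0 (mod6r⇒mod3 r (^ᶻ-injective {m ℤ.+ m} {0ℤ} (begin
      ρ ^ᶻ (m ℤ.+ m)    ≈⟨ ^ᶻ-homo-* m m ⟩
      ρ ^ᶻ m * ρ ^ᶻ m   ≈⟨ *-cong -1≈ -1≈ ⟨
      (- 1#) * (- 1#)   ≈⟨ -1*x≈-x (- 1#) ⟩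
      - - 1#            ≈⟨ -‿involutive 1# ⟩
      1#                ∎))) , -1≈

  Class-neg : ∀ {i x} → Class i x → Class i (- x)
  Class-neg {i} {x} Cx = Class-resp (ℤ/.identityˡ 3 i) (-1*x≈-x x) (Class-* -1∈Class0 Cx)

  C³⇒Class : ∀ {i x} → C³ ρ r i x → Class i x
  C³⇒Class {i} (j , _ , x≈) = + 3 ℤ.* + j ℤ.+ i , mod (divides (+ j) (eq (+ j) i)) , x≈
    where
    eq : ∀ j i → (+ 3 ℤ.* j ℤ.+ i) ℤ.- i ≡ j ℤ.* + 3
    eq = solve-∀

  Class⇒C³ : ∀ {i x} → Class i x → C³ ρ r i x
  Class⇒C³ {i} (m , mod (divides k m-i≡k*3) , x≈) =
    k %ℕ (2 ℕ.* r) , n%ℕd<d k (2 ℕ.* r) , trans x≈ (sym (^ᶻ-≡mod period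
      (3t+i≡m[mod6r] r {m = m} m-i≡k*3 (%ℕ-≡mod (2 ℕ.* r) k))))

  x*[u-1]≈x*u-x : ∀ x u → x * (u - 1#) ≈ x * u - x
  x*[u-1]≈x*u-x x u = trans (x[y-z]≈xy-xz x u 1#) (+-congˡ (-‿cong (*-identityʳ x)))

  x-[x-y]≈y : ∀ x y → x - (x - y) ≈ y
  x-[x-y]≈y x y = begin
    x - (x - y)      ≈⟨ +-congˡ (⁻¹-anti-homo-// x y) ⟩
    x + (y - x)      ≈⟨ +-congˡ (+-comm y (- x)) ⟩
    x + (- x + y)    ≈⟨ +-assoc x (- x) y ⟨
    (x - x) + y      ≈⟨ +-congʳ (-‿inverseʳ x) ⟩
    0# + y           ≈⟨ +-identityˡ y ⟩
    y                ∎

  module _ {c} (∣c³∣ : ∣ c³-set ρ r (+ 1) (+ 2) ∣≡ c) where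

    -- The set counted by `c³-set`, with the witness `y` of `u ≈ y + 1#` replaced by `u - 1#`.
    Consecutive : Pred Carrier ℓ
    Consecutive u = Class (+ 2) u × Class (+ 1) (u - 1#)

    ∣Consecutive∣ : ∣ setoid ↾ Consecutive ∣≡ c
    ∣Consecutive∣ = ↾-≐
      ( (λ ((y , y∈ , u≈y+1) , u∈) → C³⇒Class u∈ ,
          Class-resp (ℤ/.refl 3) (sym (trans (+-congʳ u≈y+1) (//-rightDividesʳ 1# y))) (C³⇒Class y∈))
      , (λ {u} (u∈ , u-1∈) → (u - 1# , Class⇒C³ u-1∈ , sym (//-rightDividesˡ 1# u)) , Class⇒C³ u∈))
      ∣c³∣

    private
      -k+[k+i]≡i : ∀ k {i} → ℤ.- k ℤ.+ (k ℤ.+ i) ≡ i [mod 3 ]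
      -k+[k+i]≡i k {i} = ≡⇒≡mod 3 (eq k i)
        where
        eq : ∀ k i → ℤ.- k ℤ.+ (k ℤ.+ i) ≡ i
        eq = solve-∀

    -- The substitution y = x u.
    ∣Class[k+2]∩Class[k+1]+x∣ : ∀ {k x} → Class k x →
      ∣ setoid ↾ (λ y → Class (k ℤ.+ + 2) y × Class (k ℤ.+ + 1) (y - x)) ∣≡ c
    ∣Class[k+2]∩Class[k+1]+x∣ {k} {x} Cx = ∣∣-resp-↔ (↾-↔ scale
      (λ {u} (u∈ , u-1∈) → Class-* Cx u∈
                         , Class-resp (ℤ/.refl 3) (x*[u-1]≈x*u-x x u) (Class-* Cx u-1∈))
      (λ {y} (y∈ , y-x∈) → Class-resp (-k+[k+i]≡i k) refl (Class-* (Class-⁻¹ Cx) y∈)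
                         , Class-resp (-k+[k+i]≡i k) (divide y) (Class-* (Class-⁻¹ Cx) y-x∈)))
      ∣Consecutive∣
      where
      x≉0 : ¬ (x ≈ 0#)
      x≉0 = Class-nonZero Cx

      scale : Inverse setoid setoid
      scale = mkInverse setoid setoid (x *_) (x ⁻¹ *_) *-congˡ *-congˡ
                (x*[x⁻¹*y]≈y x≉0) (x⁻¹*[x*y]≈y x≉0)

      divide : ∀ y → x ⁻¹ * (y - x) ≈ x ⁻¹ * y - 1#
      divide y = trans (x[y-z]≈xy-xz (x ⁻¹) y x)
                   (+-congˡ (-‿cong (trans (*-comm (x ⁻¹) x) (*-inverseʳ x x≉0))))

    -- The reflection y ↦ x - y swaps the two conditions up to sign, and classes ignore signs.
    ∣Class[k+1]∩Class[k+2]+x∣ : ∀ {k x} → Class k x →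
      ∣ setoid ↾ (λ y → Class (k ℤ.+ + 1) y × Class (k ℤ.+ + 2) (y - x)) ∣≡ c
    ∣Class[k+1]∩Class[k+2]+x∣ {k} {x} Cx = ∣∣-resp-↔ (↾-↔ reflect
      (λ {y} (y∈ , y-x∈) → negated y-x∈
                         , Class-resp (ℤ/.refl 3) (sym (x-y-x≈-y y)) (Class-neg y∈))
      (λ {y} (y∈ , y-x∈) → negated y-x∈
                         , Class-resp (ℤ/.refl 3) (sym (x-y-x≈-y y)) (Class-neg y∈)))
      (∣Class[k+2]∩Class[k+1]+x∣ Cx)
      where
      reflect : Inverse setoid setoid
      reflect = mkInverse setoid setoid (λ y → x - y) (λ y → x - y)
        (λ eq → +-congˡ (-‿cong eq)) (λ eq → +-congˡ (-‿cong eq)) (x-[x-y]≈y x) (x-[x-y]≈y x)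

      negated : ∀ {i y} → Class i (y - x) → Class i (x - y)
      negated {i} {y} y-x∈ = Class-resp (ℤ/.refl 3) (⁻¹-anti-homo-// y x) (Class-neg y-x∈)

      x-y-x≈-y : ∀ y → (x - y) - x ≈ - y
      x-y-x≈-y y = begin
        (x - y) - x      ≈⟨ +-congʳ (+-comm x (- y)) ⟩
        (- y + x) - x    ≈⟨ //-rightDividesʳ x (- y) ⟩
        - y              ∎

-- Labels by cubic classes

open import Data.Nat.Base using (_+_; _*_)

HasExponentTwo : AbelianGroup a ℓ → Set (a Level.⊔ ℓ)
HasExponentTwo G = ∀ x → x ∙ x ≈ ε
  where open AbelianGroup G

-- `Z` stands for `ℤ₂²`, which contributes exponent two and, through `π`, exactly three nonzero
-- elements.
module CubicLabelling
  (B Z : AbelianGroup 0ℓ 0ℓ) (z∙z≈ε : HasExponentTwo Z)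
  (π : Bijection (Z *) (AbelianGroup.setoid (ℤ/ 3)))
  (F : Field a ℓ) {ρ : Field.Carrier F} (isPrimitive : Cyclotomy.IsPrimitive F ρ)
  (r : ℕ) .{{_ : ℕ.NonZero r}} (∣F*∣ : ∣ Field.+-abelianGroup F * ∣≡ 6 * r)
  where

  private
    module B = AbelianGroup B
    module Z = AbelianGroup Z
    module Zᵖ = AbelianGroupProperties Z
    A : AbelianGroup 0ℓ 0ℓ
    A = B ⊕ Z
    module A = AbelianGroup A
    module F = Field F
    module π = Bijection π

  open CubicClasses F isPrimitive r ∣F*∣

  infix 4 _▷_
  -- The label of `x` is `(ε , z)`, where `π` sends `z` to the cubic class of `x`. The relational
  -- form follows `S[_]`.
  _▷_ : A.Carrier → F.Carrier → Set ℓ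
  (b , z) ▷ x = b B.≈ B.ε × (Σ[ z≉ε ∈ ¬ (z Z.≈ Z.ε) ] Class (π.to (z , z≉ε)) x)

  isLabelling : IsLabelling A F.+-abelianGroup _▷_
  isLabelling = record
    { resp       = λ (b≈ , z≈) x≈ (b≈ε , z≉ε , x∈) → B.trans (B.sym b≈) b≈ε
                     , z≉ε ∘ Z.trans z≈ , Class-resp (π.cong z≈) x≈ x∈
    ; label      = λ x≉0 → let i , x∈ = Class-total x≉0; (z , z≉ε) = π.to⁻ i in
                     (B.ε , z) , B.refl , z≉ε
                     , Class-resp (ℤ/.sym 3 (π-to∘to⁻ i)) F.refl x∈
    ; unique     = λ (b≈ε , _ , x∈) (b′≈ε , _ , x∈′) → B.trans b≈ε (B.sym b′≈ε)
                     , π.injective (Class-unique x∈ x∈′)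
    ; label≉ε    = λ (_ , z≉ε , _) (_ , z≈ε) → z≉ε z≈ε
    ; support    = λ (_ , _ , x∈) → Class-nonZero x∈
    ; involutive = λ (b≈ε , _ , _) → B.trans (B.∙-cong b≈ε b≈ε) (B.identityˡ B.ε) , z∙z≈ε _
    ; symmetric  = λ (b≈ε , z≉ε , x∈) → b≈ε , z≉ε , Class-neg x∈
    }
    where
    π-to∘to⁻ : ∀ i → π.to (π.to⁻ i) ≡ i [mod 3 ]
    π-to∘to⁻ i = proj₂ (π.strictlySurjective i)

  -- For z and z′ with distinct images, z, z′ and z′ - z are the three nonzero elements.
  third : ∀ {z z′} (z≉ε : ¬ (z Z.≈ Z.ε)) (z′≉ε : ¬ (z′ Z.≈ Z.ε)) →
          ¬ (π.to (z′ , z′≉ε) ≡ π.to (z , z≉ε) [mod 3 ]) →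
          Σ[ d≉ε ∈ ¬ (z′ Z.- z Z.≈ Z.ε) ] ¬ (π.to (z′ Z.- z , d≉ε) ≡ π.to (z , z≉ε) [mod 3 ])
                                          × ¬ (π.to (z′ Z.- z , d≉ε) ≡ π.to (z′ , z′≉ε) [mod 3 ])
  third {z} {z′} z≉ε z′≉ε πz′≢πz =
    (λ d≈ε → πz′≢πz (π.cong (Zᵖ.x∙y⁻¹≈ε⇒x≈y z′ z d≈ε))) ,
    -- Injectivity of `π` would give `z′ - z ≈ z`, hence `z′ ≈ z ∙ z ≈ ε`; in the next case it would
    -- give `z′ - z ≈ z′`, hence `z ≈ ε`.
    (λ eq → z′≉ε (Z.trans (Z.sym (Zᵖ.//-rightDividesˡ z z′))
                    (Z.trans (Z.∙-congʳ (π.injective eq)) (z∙z≈ε z)))) ,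
    (λ eq → z≉ε (Zᵖ.⁻¹-injective (Z.trans (Zᵖ.∙-cancelˡ z′ (z Z.⁻¹) Z.ε
      (Z.trans (π.injective eq) (Z.sym (Z.identityʳ z′)))) (Z.sym Zᵖ.ε⁻¹≈ε))))

  module _ {c} (∣c³∣ : ∣ Cyclotomy.c³-set F ρ r (+ 1) (+ 2) ∣≡ c) where

    ∣commonLabels∣ : ∀ {g x} → g ▷ x →
      ∣ F.setoid ↾ (λ y → ∃[ a ] a ▷ y × (a A.- g) ▷ (y F.- x)) ∣≡ c + c
    ∣commonLabels∣ {b , z} {x} (b≈ε , z≉ε , x∈) = ↾-≐ (to , from)
      (∣∪∣ F.setoid disjoint (∣Class[k+1]∩Class[k+2]+x∣ ∣c³∣ x∈) (∣Class[k+2]∩Class[k+1]+x∣ ∣c³∣ x∈))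
      where
      k : ℤ
      k = π.to (z , z≉ε)

      Successive : (i j : ℤ) → Pred F.Carrier ℓ
      Successive i j y = Class (k ℤ.+ i) y × Class (k ℤ.+ j) (y F.- x)

      disjoint : ∀ {y y′} → Successive (+ 1) (+ 2) y → Successive (+ 2) (+ 1) y′ → ¬ (y F.≈ y′)
      disjoint (y∈ , _) (y′∈ , _) y≈y′ =
        k+1≢k+2 k (Class-unique (Class-resp (ℤ/.refl 3) y≈y′ y∈) y′∈)

      -- `z′` is the preimage of `k + i` under `π`. By `third` the class of `z′ - z` is neither `k`
      -- nor `k + i`, and `other` identifies it as `k + j`.
      fromSuccessive : ∀ {i j y} → ¬ (k ℤ.+ i ≡ k [mod 3 ]) →
        (∀ m → ¬ (m ≡ k [mod 3 ]) → ¬ (m ≡ k ℤ.+ i [mod 3 ]) → m ≡ k ℤ.+ j [mod 3 ]) →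
        Successive i j y → ∃[ a ] a ▷ y × (a A.- (b , z)) ▷ (y F.- x)
      fromSuccessive {i} {j} {y} k+i≢k other (y∈ , y-x∈)
        with z′ , z′≉ε ← π.to⁻ (k ℤ.+ i) | πz′≡k+i ← proj₂ (π.strictlySurjective (k ℤ.+ i))
        with d≉ε , πd≢k , πd≢πz′ ← third z≉ε z′≉ε (k+i≢k ∘ ℤ/.trans 3 (ℤ/.sym 3 πz′≡k+i)) =
        (B.ε , z′) ,
        (B.refl , z′≉ε , Class-resp (ℤ/.sym 3 πz′≡k+i) F.refl y∈) ,
        ( B.trans (B.∙-congˡ (B.⁻¹-cong b≈ε)) (B.inverseʳ B.ε) , d≉ε
        , Class-resp (ℤ/.sym 3 (other _ πd≢k (λ eq → πd≢πz′ (ℤ/.trans 3 eq (ℤ/.sym 3 πz′≡k+i)))))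
                     F.refl y-x∈)

      to : ∀ {y} → (Successive (+ 1) (+ 2) ∪ Successive (+ 2) (+ 1)) y →
           ∃[ a ] a ▷ y × (a A.- (b , z)) ▷ (y F.- x)
      to (inj₁ y∈) = fromSuccessive (k+1≢k k) (λ m m≢k m≢k+1 → [ (λ eq → contradiction eq m≢k) ,
        [ (λ eq → contradiction eq m≢k+1) , id ]′ ]′ (mod3-cases k m)) y∈
      to (inj₂ y∈) = fromSuccessive (k+2≢k k) (λ m m≢k m≢k+2 → [ (λ eq → contradiction eq m≢k) ,
        [ id , (λ eq → contradiction eq m≢k+2) ]′ ]′ (mod3-cases k m)) y∈

      from : ∀ {y} → ∃[ a ] a ▷ y × (a A.- (b , z)) ▷ (y F.- x) →
             (Successive (+ 1) (+ 2) ∪ Successive (+ 2) (+ 1)) y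
      from {y} ((_ , z′) , (_ , z′≉ε , y∈) , (_ , d≉ε , y-x∈)) =
        cases (mod3-cases k _) (mod3-cases k _)
        where
        πz′≢k : ¬ (π.to (z′ , z′≉ε) ≡ k [mod 3 ])
        πz′≢k eq = d≉ε (Zᵖ.x≈y⇒x∙y⁻¹≈ε (π.injective eq))

        πd≢k : ¬ (π.to (z′ Z.- z , d≉ε) ≡ k [mod 3 ])
        -- `π.to` also takes a proof of being nonzero; `π.cong` identifies its values at `d≉ε` and
        -- at the proof supplied by `third`.
        πd≢k eq = proj₁ (proj₂ (third z≉ε z′≉ε πz′≢k)) (ℤ/.trans 3 (π.cong Z.refl) eq)

        πd≢πz′ : ∀ {i} → π.to (z′ , z′≉ε) ≡ k ℤ.+ i [mod 3 ] →
                 ¬ (π.to (z′ Z.- z , d≉ε) ≡ k ℤ.+ i [mod 3 ])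
        πd≢πz′ eq′ eq = proj₂ (proj₂ (third z≉ε z′≉ε πz′≢k))
          (ℤ/.trans 3 (π.cong Z.refl) (ℤ/.trans 3 eq (ℤ/.sym 3 eq′)))

        Cases : ℤ → Set
        Cases i = i ≡ k [mod 3 ] ⊎ i ≡ k ℤ.+ + 1 [mod 3 ] ⊎ i ≡ k ℤ.+ + 2 [mod 3 ]

        cases : Cases (π.to (z′ , z′≉ε)) → Cases (π.to (z′ Z.- z , d≉ε)) →
                (Successive (+ 1) (+ 2) ∪ Successive (+ 2) (+ 1)) y
        cases (inj₁ eq)        _                = contradiction eq πz′≢k
        cases _                (inj₁ eq)        = contradiction eq πd≢k
        cases (inj₂ (inj₁ eq)) (inj₂ (inj₁ eq′)) = contradiction eq′ (πd≢πz′ eq)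
        cases (inj₂ (inj₂ eq)) (inj₂ (inj₂ eq′)) = contradiction eq′ (πd≢πz′ eq)
        cases (inj₂ (inj₁ eq)) (inj₂ (inj₂ eq′)) =
          inj₁ (Class-resp eq F.refl y∈ , Class-resp eq′ F.refl y-x∈)
        cases (inj₂ (inj₂ eq)) (inj₂ (inj₁ eq′)) =
          inj₂ (Class-resp eq F.refl y∈ , Class-resp eq′ F.refl y-x∈)

-- Arithmetic of `c` and `l`, and specialisation to `ℤ/ l` and `ℤ₂²`

ℤ₂²-exponentTwo : HasExponentTwo ℤ₂²
ℤ₂²-exponentTwo (x , y) = mod (divides x (eq x)) , mod (divides y (eq y))
  where
  eq : ∀ x → x ℤ.+ x ℤ.- 0ℤ ≡ x ℤ.* + 2
  eq = solve-∀

-- Writing `c = 2 h + 1` gives `l = h + 1`, and both sides equal `4 h + 2`.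
c+c≡4l∸2 : ∀ c {l} → c % 2 ≡ 1 → l ≡ (c + 1) / 2 → c + c ≡ 4 * l ∸ 2
c+c≡4l∸2 c {l} c%2≡1 l≡ = begin
  c + c                              ≡⟨ ≡.cong₂ _+_ c≡ c≡ ⟩
  (1 + h * 2) + (1 + h * 2)          ≡⟨ ℕ.m+n∸n≡m _ 2 ⟨
  (1 + h * 2) + (1 + h * 2) + 2 ∸ 2  ≡⟨ ≡.cong (_∸ 2) (regroup h) ⟩
  4 * (1 + h) ∸ 2                    ≡⟨ ≡.cong (λ l → 4 * l ∸ 2) l≡1+h ⟨
  4 * l ∸ 2                          ∎
  where
  open ≡.≡-Reasoning

  h : ℕ
  h = c / 2

  c≡ : c ≡ 1 + h * 2
  c≡ = ≡.trans (ℕ.m≡m%n+[m/n]*n c 2) (≡.cong (_+ h * 2) c%2≡1)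

  regroup : ∀ h → (1 + h * 2) + (1 + h * 2) + 2 ≡ 4 * (1 + h)
  regroup = ℕSolver.solve-∀

  double : ∀ h → 1 + h * 2 + 1 ≡ (1 + h) * 2
  double = ℕSolver.solve-∀

  l≡1+h : l ≡ 1 + h
  l≡1+h = begin
    l                    ≡⟨ l≡ ⟩
    (c + 1) / 2          ≡⟨ ≡.cong (λ c → (c + 1) / 2) c≡ ⟩
    (1 + h * 2 + 1) / 2  ≡⟨ ≡.cong (_/ 2) (double h) ⟩
    (1 + h) * 2 / 2      ≡⟨ ℕ.m*n/n≡m (1 + h) 2 ⟩
    1 + h                ∎

-- At `l = 0` the right side truncates to zero, while an odd `c` makes the left side positive. The
-- case must be excluded because `ℤ/ 0` is the infinite group of integers.
c+c≡4l∸2⇒l≢0 : ∀ {c} → c % 2 ≡ 1 → ∀ {l} → c + c ≡ 4 * l ∸ 2 → ℕ.NonZero l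
c+c≡4l∸2⇒l≢0 {zero}  ()    _
c+c≡4l∸2⇒l≢0 {suc _} _ {zero}  ()
c+c≡4l∸2⇒l≢0 {suc _} _ {suc _} _ = _

theorem3p6 : ∀ {a ℓ} (q r : ℕ) → IsPrimePower q → q ≡ 6 * r + 1 →
    (F : Field a ℓ) → ∣ Field.setoid F ∣≡ q →
    (ρ : Field.Carrier F) → Cyclotomy.IsPrimitive F ρ →
    (π : Bijection (ℤ₂² *) (AbelianGroup.setoid (ℤ/ 3))) →
    (c l : ℕ) → ∣ Cyclotomy.c³-set F ρ r (+ 1) (+ 2) ∣≡ c →
    c % 2 ≡ 1 → l ≡ (c + 1) / 2 →
    let Γ = Cay (Construction.G l F ρ π) (Construction.S l F ρ π) in
    IsEdgeRegular Γ (4 * l * q) (4 * l ∸ 2 + q) (4 * l ∸ 2)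
    × HasRegularCliqueOfOrder Γ (4 * l)
theorem3p6 {ℓ = ℓ} q r _ q≡6r+1 F ∣F∣ ρ isPrimitive π c l ∣c³∣ c%2≡1 l≡ =
  -- The choice of `l` enters here: it makes the `c + c` common neighbours of an oblique edge match
  -- the `4 * l ∸ 2` of a horizontal one.
  isEdgeRegular ∣A∣ ∣F∣ (F.1# , F.1≉0) (∣∣-resp-≡ (c+c≡4l∸2 c c%2≡1 l≡) ∘ ∣commonLabels∣ ∣c³∣) ,
  hasRegularClique ∣A∣ ∣F∣
  where
  module F = Field F

  instance
    l≢0 : ℕ.NonZero l
    l≢0 = c+c≡4l∸2⇒l≢0 {c} c%2≡1 (c+c≡4l∸2 c c%2≡1 l≡)

  ∣F*∣ : ∣ F.+-abelianGroup * ∣≡ 6 * r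
  ∣F*∣ = ∣∣-resp-≡ (≡.trans (≡.cong (_∸ 1) q≡6r+1) (ℕ.m+n∸n≡m (6 * r) 1)) (∣≉∣ F.setoid F.0# ∣F∣)

  -- At `r = 0` the field would have no nonzero element, contrary to `1≉0`.
  instance
    r≢0 : ℕ.NonZero r
    r≢0 = ℕ.≢-nonZero λ where ≡.refl → inhabited-∣∣≡0 (F.1# , F.1≉0) ∣F*∣

  A : AbelianGroup 0ℓ 0ℓ
  A = ℤ/ l ⊕ ℤ₂²

  module A = AbelianGroup A
  module ℤ₂² = AbelianGroup ℤ₂²

  ∣A∣ : ∣ A.setoid ∣≡ 4 * l
  ∣A∣ = ∣∣-resp-≡ (ℕ.*-comm l 4) (∣×∣ (∣ℤ/∣ l) (∣×∣ (∣ℤ/∣ 2) (∣ℤ/∣ 2)))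

  open CubicLabelling (ℤ/ l) ℤ₂² ℤ₂²-exponentTwo π F isPrimitive r ∣F*∣

  S⇒ : Construction.S l F ρ π ⊆ (λ (a , x) → x F.≈ F.0# × ¬ (a A.≈ A.ε)) ∪ λ (a , x) → a ▷ x
  S⇒ (inj₁ ((g , g≉ε) , a≈g , x≈0)) = inj₁ (x≈0 , g≉ε ∘ A.trans (A.sym a≈g))
  S⇒ (inj₂ ((z , z≉ε) , j , j≡πz , (b≈0 , y≈z) , x≈ρʲ)) = inj₂
    ( b≈0 , z≉ε ∘ ℤ₂².trans (ℤ₂².sym y≈z)
    , j , ℤ/.trans 3 j≡πz (Bijection.cong π (ℤ₂².sym y≈z)) , x≈ρʲ)

  ⇒S : (λ (a , x) → x F.≈ F.0# × ¬ (a A.≈ A.ε)) ∪ (λ (a , x) → a ▷ x) ⊆ Construction.S l F ρ π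
  ⇒S {a , _} (inj₁ (x≈0 , a≉ε)) = inj₁ ((a , a≉ε) , A.refl , x≈0)
  ⇒S {(_ , z) , _} (inj₂ (b≈0 , z≉ε , j , j≡πz , x≈ρʲ)) =
    inj₂ ((z , z≉ε) , j , j≡πz , (b≈0 , ℤ₂².refl) , x≈ρʲ)

  open Labelled A F.+-abelianGroup isLabelling (S⇒ , ⇒S)
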